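{- Let $n\ge 2$ be an integer. Then $\mathcal{B}(n+1,n)\le\binom{n}{2}$ if $n$ is odd, and $\mathcal{B}(n+1,n)\le\binom{n}{2}-1$ if $n$ is even.
   Context: An orthogonal array $\mathrm{OA}(k,n)$ on an alphabet $\Lambda$ with $|\Lambda|=n$ is an $n^2\times k$ matrix $A=(a_{r\ell})$ with entries in $\Lambda$ such that in every pair of distinct columns each ordered pair in $\Lambda^2$ occurs in exactly one row. For distinct columns $c,i,j\in\{1,\dots,k\}$ and $s\in\Lambda$, let $\rho_s(c,i,j)$ be the permutation of $\Lambda$ mapping $a_{ri}\mapsto a_{rj}$ for all rows $r$ with $a_{rc}=s$. With $\pi(\gamma)\in\mathbb{Z}_2$ denoting the parity of a permutation $\gamma$ ($0$ for even, $1$ for odd), define $\tau^c_{ij}(A)=\sum_{s\in\Lambda}\pi(\rho_s(c,i,j))\in\mathbb{Z}_2$. The $\tau$-parity of $A$ is the vector $(\tau^c_{ij}(A))$ indexed by the $k(k-1)(k-2)$ ordered triples $(c,i,j)$ of distinct elements of $\{1,\dots,k\}$. $\mathcal{B}(k,n)$ denotes $\log_2$ of the number of different $\tau$-parities achieved by orthogonal arrays $\mathrm{OA}(k,n)$ (on a fixed alphabet of size $n$); if no $\mathrm{OA}(k,n)$ exists we use the convention $\log_2 0=-\infty$. -}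

module Defs where

open import Data.Bool.Base using (if_then_else_; _∧_)
open import Data.Empty using (⊥-elim)
open import Data.Fin.Base using (Fin; finToFun)
open import Data.Fin.Permutation using (Permutation′; permutation; _⟨$⟩ʳ_)
open import Data.Fin.Properties using (_≟_; _<?_; all?; any?)
open import Data.List.Base using (List; allFin; deduplicate; length; map; mapMaybe)
open import Data.Maybe.Base as Maybe using ()
open import Data.Nat.Base using (ℕ; _*_; _^_; _≤_)
open import Data.Parity.Base using (Parity; 0ℙ; 1ℙ)
import Data.Parity.Properties as ℙ
open import Data.Product using (∃!; _×_; _,_; proj₁)
open import Relation.Binary.PropositionalEquality
  using (_≡_; _≢_; refl; trans; cong)
open import Relation.Nullary.Decidable
  using (Dec; yes; no; does; map′; dec⇒maybe; ¬?; _×-dec_; _→-dec_)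

open import Algebra.Properties.CommutativeMonoid.Sum ℙ.+-0-commutativeMonoid
  using (sum)

-- The alphabet Λ is Fin n.  An entry of the matrix is  A r ℓ  with  r  the row
-- and  ℓ  the column.
Matrix : ℕ → ℕ → Set
Matrix k n = Fin (n * n) → Fin k → Fin n

IsOA : ∀ {k n} → Matrix k n → Set
IsOA A = ∀ i j → i ≢ j → ∀ x y → ∃! _≡_ λ r → A r i ≡ x × A r j ≡ y

record OA (k n : ℕ) : Set where
  field
    matrix : Matrix k n
    isOA   : IsOA matrix

-- The parity of the number of inversions, i.e. of pairs i < j with γ j < γ i.
π : ∀ {n} → Permutation′ n → Parity
π γ = sum λ i → sum λ j →
  if does (i <? j) ∧ does ((γ ⟨$⟩ʳ j) <? (γ ⟨$⟩ʳ i)) then 1ℙ else 0ℙ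

module _ {k n : ℕ} (A : OA k n) where
  open OA A renaming (matrix to a)

  -- The unique row r with a r c ≡ s and a r i ≡ x.
  row : ∀ {c i} → c ≢ i → (s x : Fin n) → Fin (n * n)
  row c≢i s x = proj₁ (isOA _ _ c≢i s x)

  translate : ∀ {c i} → c ≢ i → Fin k → Fin n → Fin n → Fin n
  translate c≢i j s x = a (row c≢i s x) j

  translate-inverse : ∀ {c i j} (c≢i : c ≢ i) (c≢j : c ≢ j) s y →
                      translate c≢i j s (translate c≢j i s y) ≡ y
  translate-inverse {c} {i} {j} c≢i c≢j s y =
    let (r , (rc≡s , rj≡y) , _) = isOA c j c≢j s y
        (_ , _ , unique) = isOA c i c≢i s (a r i)
    in trans (cong (λ q → a q j) (unique (rc≡s , refl))) rj≡y

  -- The permutation a r i ↦ a r j, over the rows r with a r c ≡ s.  It makes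
  -- sense for i ≡ j too, hence only c ≢ i and c ≢ j are required.
  ρ : ∀ {c i j} → c ≢ i → c ≢ j → Fin n → Permutation′ n
  ρ {c} {i} {j} c≢i c≢j s = permutation
    (translate c≢i j s)
    (translate c≢j i s)
    (translate-inverse c≢i c≢j s)
    (translate-inverse c≢j c≢i s)

τ-Parity : ℕ → Set
τ-Parity k = (c i j : Fin k) → c ≢ i → c ≢ j → i ≢ j → Parity

τ : ∀ {k n} → OA k n → τ-Parity k
τ A c i j c≢i c≢j _ = sum λ s → π (ρ A c≢i c≢j s)

_≈τ_ : ∀ {k} → τ-Parity k → τ-Parity k → Set
t ≈τ u = ∀ c i j (c≢i : c ≢ i) (c≢j : c ≢ j) (i≢j : i ≢ j) →
         t c i j c≢i c≢j i≢j ≡ u c i j c≢i c≢j i≢j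

-- Proofs of i ≢ j are definitionally equal.
≢-all? : ∀ {k} {i j : Fin k} {P : i ≢ j → Set} →
         (∀ i≢j → Dec (P i≢j)) → Dec (∀ i≢j → P i≢j)
≢-all? {i = i} {j} P? with i ≟ j
... | yes i≡j = yes λ i≢j → ⊥-elim (i≢j i≡j)
... | no  i≢j with P? i≢j
...   | yes p = yes λ _ → p
...   | no ¬p = no λ f → ¬p (f i≢j)

∃!? : ∀ {m} {P : Fin m → Set} → (∀ r → Dec (P r)) → Dec (∃! _≡_ P)
∃!? P? = map′
  (λ (r , p , u) → r , p , λ {r′} → u r′)
  (λ (r , p , u) → r , p , λ r′ → u {r′})
  (any? λ r → P? r ×-dec all? λ r′ → P? r′ →-dec (r ≟ r′))

_≈τ?_ : ∀ {k} (t u : τ-Parity k) → Dec (t ≈τ u)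
t ≈τ? u = all? λ c → all? λ i → all? λ j →
  ≢-all? λ c≢i → ≢-all? λ c≢j → ≢-all? λ i≢j →
  t c i j c≢i c≢j i≢j ℙ.≟ u c i j c≢i c≢j i≢j

isOA? : ∀ {k n} (A : Matrix k n) → Dec (IsOA A)
isOA? A = all? λ i → all? λ j → ¬? (i ≟ j) →-dec
  (all? λ x → all? λ y → ∃!? λ r → (A r i ≟ x) ×-dec (A r j ≟ y))

-- Each function Fin (n * n) → Fin k → Fin n occurs exactly once, up to
-- pointwise equality.
allMatrices : ∀ k n → List (Matrix k n)
allMatrices k n =
  map (λ e r → finToFun (finToFun e r)) (allFin ((n ^ k) ^ (n * n)))

allOAs : ∀ k n → List (OA k n)
allOAs k n = mapMaybe
  (λ A → Maybe.map (λ p → record { matrix = A ; isOA = p }) (dec⇒maybe (isOA? A)))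
  (allMatrices k n)

number-of-τ-parities : ℕ → ℕ → ℕ
number-of-τ-parities k n = length (deduplicate _≈τ?_ (map τ (allOAs k n)))

-- ℬ(k,n) ≤ m, where ℬ(k,n) = log₂ (number-of-τ-parities k n).  For t > 0,
-- log₂ t ≤ m means t ≤ 2 ^ m; for t = 0 the inequality t ≤ 2 ^ m always holds,
-- in accordance with log₂ 0 = -∞.
ℬ[_,_]≤_ : ℕ → ℕ → ℕ → Set
ℬ[ k , n ]≤ m = number-of-τ-parities k n ≤ 2 ^ m

{-# OPTIONS --safe #-}

-- For a row r write r_i for its entry in column i, and let f_i(j) be the parity
-- of the number of pairs of rows r < r′ whose entries (r_i , r_j) and
-- (r′_i , r′_j) are in reverse lexicographic order.  Then τ^c_ij = f_c(i) + f_c(j),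
-- and f_i(j) + f_j(i) depends on n only, since the rows run through all pairs of
-- symbols in the columns i and j.  If k = n + 1 then distinct rows agree in
-- exactly one column; hence Σ_{i ≠ j} f_i(j) is the total number of inversions
-- of all columns and does not depend on j.
--
-- For two arrays let D be the sum of their functions f.  It is symmetric off the
-- diagonal with all column sums equal, and the τ-parities agree as soon as D is
-- constant off the diagonal.  If D is constantly a away from column 0, then the
-- column sums force it to be constant in column 0 as well; that constant is a
-- automatically when n is even, and otherwise is fixed by one more bit.

module Submission where

open import Defs
open import Data.Bool.Base using (Bool; true; false; if_then_else_; _∧_)
open import Data.Fin.Base using (Fin; zero; suc; punchIn; splitAt; _↑ˡ_; _↑ʳ_; funToFin; finToFun)
  renaming (_<_ to _<ᶠ_)
open import Data.Fin.Properties
  using (_≟_; _<?_; <-cmp; pigeonhole; suc-injective; 0≢1+n; punchInᵢ≢i;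
         splitAt-↑ˡ; splitAt-↑ʳ; finToFun-funToFin; <⇒≢)
open import Data.List.Base using (List; _∷_; deduplicate; length; lookup; map)
open import Data.List.Membership.Propositional.Properties using (∈-lookup; ∈-map⁻; ∈-deduplicate⁻)
import Data.List.Relation.Unary.All as All
open import Data.List.Relation.Unary.AllPairs.Core using (AllPairs; _∷_)
open import Data.List.Relation.Unary.Unique.DecSetoid.Properties using (deduplicate-!)
open import Data.Nat.Base using (ℕ; zero; suc; _+_; _*_; _^_; _≤_; _<_; _∸_; s≤s; s<s)
open import Data.Nat.Combinatorics using (_C_; nC1≡n; nCk+nC[k+1]≡[n+1]C[k+1])
open import Data.Nat.Divisibility using (_∣_; _∤_; divides)
open import Data.Nat.Properties using (≮⇒≥; ≤-refl)
open import Data.Parity.Base as ℙ using (Parity; 0ℙ; 1ℙ)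
import Data.Parity.Properties as ℙ
open import Data.Product.Base using (_×_; _,_; proj₁; proj₂; ∃; uncurry)
import Data.Product.Base as Product
open import Data.Sum.Base using ([_,_]′)
open import Function.Base using (_∘_)
open import Function.Bundles using (mk⇔)
open import Level using (0ℓ)
open import Relation.Binary.Bundles using (DecSetoid)
open import Relation.Binary.Definitions using (tri<; tri≈; tri>)
open import Relation.Binary.PropositionalEquality
  using (_≡_; _≢_; refl; sym; trans; cong; cong₂; subst; subst₂; module ≡-Reasoning)
open import Relation.Nullary.Decidable
  using (yes; no; does; dec-true; dec-false; does-⇔; _×-dec_)
open import Relation.Nullary.Negation using (contradiction)

open import Algebra.Properties.Semiring.Sum ℙ.+-*-semiring
  using (sum; sum-syntax; sum-cong-≗; sum-replicate-zero; sum-remove;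
         ∑-distrib-+; ∑-comm; *-distribˡ-sum; *-distribʳ-sum)

open ≡-Reasoning

private
  variable
    k m n : ℕ

-- Arithmetic and finite sums in ℤ₂

infixl 6 _⊕_
infixl 7 _⊗_

_⊕_ _⊗_ : Parity → Parity → Parity
_⊕_ = ℙ._+_
_⊗_ = ℙ._*_

-- Every element of ℤ₂ is its own negative. This passes between equations within each array and
-- equations between sums over two arrays.
⊕-exchange : ∀ p q r s → p ⊕ q ≡ r ⊕ s → p ⊕ r ≡ q ⊕ s
⊕-exchange 0ℙ q 0ℙ s refl = sym (ℙ.p+p≡0ℙ s)
⊕-exchange 0ℙ q 1ℙ s refl = sym (ℙ.p⁻¹+p≡1ℙ s)
⊕-exchange 1ℙ 0ℙ 0ℙ 1ℙ _  = refl
⊕-exchange 1ℙ 1ℙ 0ℙ 0ℙ _  = refl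
⊕-exchange 1ℙ 0ℙ 1ℙ 0ℙ _  = refl
⊕-exchange 1ℙ 1ℙ 1ℙ 1ℙ _  = refl

⊕-transpose : ∀ p q {r} → p ⊕ q ≡ r → p ≡ r ⊕ q
⊕-transpose 0ℙ q  refl = sym (ℙ.p+p≡0ℙ q)
⊕-transpose 1ℙ q  refl = sym (ℙ.p⁻¹+p≡1ℙ q)

sum-const-even : ∀ q p → sum {q * 2} (λ _ → p) ≡ 0ℙ
sum-const-even zero    p = refl
sum-const-even (suc q) p = begin
  p ⊕ (p ⊕ sum {q * 2} (λ _ → p))  ≡⟨ cong (λ s → p ⊕ (p ⊕ s)) (sum-const-even q p) ⟩
  p ⊕ (p ⊕ 0ℙ)                     ≡⟨ cong (p ⊕_) (ℙ.+-identityʳ p) ⟩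
  p ⊕ p                            ≡⟨ ℙ.p+p≡0ℙ p ⟩
  0ℙ                               ∎

∑∑-cong : {F G : Fin m → Fin n → Parity} → (∀ i j → F i j ≡ G i j) →
          ∑[ i < m ] ∑[ j < n ] F i j ≡ ∑[ i < m ] ∑[ j < n ] G i j
∑∑-cong F≡G = sum-cong-≗ λ i → sum-cong-≗ (F≡G i)

∑∑-distrib-+ : (F G : Fin m → Fin n → Parity) →
               ∑[ i < m ] ∑[ j < n ] (F i j ⊕ G i j) ≡
               (∑[ i < m ] ∑[ j < n ] F i j) ⊕ (∑[ i < m ] ∑[ j < n ] G i j)
∑∑-distrib-+ F G = trans (sum-cong-≗ λ i → ∑-distrib-+ (F i) (G i))
                         (∑-distrib-+ (λ i → sum (F i)) (λ i → sum (G i)))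

-- Indicators

⟦_⟧ : Bool → Parity
⟦ b ⟧ = if b then 1ℙ else 0ℙ

⟦∧⟧ : ∀ b c → ⟦ b ∧ c ⟧ ≡ ⟦ b ⟧ ⊗ ⟦ c ⟧
⟦∧⟧ true  c = refl
⟦∧⟧ false c = refl

eq lt : Fin n → Fin n → Parity
eq x y = ⟦ does (x ≟ y) ⟧
lt x y = ⟦ does (x <? y) ⟧

eq-sym : (x y : Fin n) → eq x y ≡ eq y x
eq-sym x y = cong ⟦_⟧ (does-⇔ (mk⇔ sym sym) (x ≟ y) (y ≟ x))

lt-irrefl : (x : Fin n) → lt x x ≡ 0ℙ
lt-irrefl x = cong ⟦_⟧ (dec-false (x <? x) λ x<x → <⇒≢ x<x refl)

-- Indexed by the indicators of <, = and >, so that matching replaces all three by constants and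
-- identities between them become finite case checks.
data Comparison : (l e g : Parity) → Set where
  less    : Comparison 1ℙ 0ℙ 0ℙ
  equal   : Comparison 0ℙ 1ℙ 0ℙ
  greater : Comparison 0ℙ 0ℙ 1ℙ

compare : (x y : Fin n) → Comparison (lt x y) (eq x y) (lt y x)
compare x y with <-cmp x y
... | tri< l e g rewrite dec-true (x <? y) l | dec-false (x ≟ y) e | dec-false (y <? x) g = less
... | tri≈ l e g rewrite dec-false (x <? y) l | dec-true (x ≟ y) e | dec-false (y <? x) g = equal
... | tri> l e g rewrite dec-false (x <? y) l | dec-false (x ≟ y) e | dec-true (y <? x) g = greater

sum-eq : (j : Fin n) (h : Fin n → Parity) → ∑[ i < n ] (eq i j ⊗ h i) ≡ h j
sum-eq {suc n} zero    h = trans (cong (h zero ⊕_) (sum-replicate-zero n)) (ℙ.+-identityʳ _)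
sum-eq {suc n} (suc j) h = sum-eq j (h ∘ suc)

-- Sums over pairs r < r′

pairSum : (Fin m → Fin m → Parity) → Parity
pairSum {m} G = ∑[ r < m ] ∑[ r′ < m ] (lt r r′ ⊗ G r r′)

pairSum-cong : {G H : Fin m → Fin m → Parity} →
               (∀ r r′ → r ≢ r′ → G r r′ ≡ H r r′) → pairSum G ≡ pairSum H
pairSum-cong {G = G} {H} G≡H = ∑∑-cong pointwise
  where
  pointwise : ∀ r r′ → lt r r′ ⊗ G r r′ ≡ lt r r′ ⊗ H r r′
  pointwise r r′ with r ≟ r′
  ... | yes refl rewrite lt-irrefl r = refl
  ... | no  r≢r′ = cong (lt r r′ ⊗_) (G≡H r r′ r≢r′)

pairSum-distrib-+ : (G H : Fin m → Fin m → Parity) →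
                    pairSum (λ r r′ → G r r′ ⊕ H r r′) ≡ pairSum G ⊕ pairSum H
pairSum-distrib-+ G H = trans
  (∑∑-cong λ r r′ → ℙ.*-distribˡ-+ (lt r r′) (G r r′) (H r r′))
  (∑∑-distrib-+ (λ r r′ → lt r r′ ⊗ G r r′) (λ r r′ → lt r r′ ⊗ H r r′))

sum-pairSum : (G : Fin n → Fin m → Fin m → Parity) →
              ∑[ i < n ] pairSum (G i) ≡ pairSum (λ r r′ → ∑[ i < n ] G i r r′)
sum-pairSum {n} {m} G = begin
  ∑[ i < n ] ∑[ r < m ] ∑[ r′ < m ] (lt r r′ ⊗ G i r r′)
    ≡⟨ ∑-comm (λ i r → ∑[ r′ < m ] (lt r r′ ⊗ G i r r′)) ⟩
  ∑[ r < m ] ∑[ i < n ] ∑[ r′ < m ] (lt r r′ ⊗ G i r r′)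
    ≡⟨ sum-cong-≗ (λ r → ∑-comm (λ i r′ → lt r r′ ⊗ G i r r′)) ⟩
  ∑[ r < m ] ∑[ r′ < m ] ∑[ i < n ] (lt r r′ ⊗ G i r r′)
    ≡⟨ ∑∑-cong (λ r r′ → *-distribˡ-sum (lt r r′) (λ i → G i r r′)) ⟨
  pairSum (λ r r′ → ∑[ i < n ] G i r r′) ∎

-- Renaming r and r′ turns the second summand into a sum over r > r′. Together the two cover
-- everything off the diagonal, where alone `G` can be nonzero.
pairSum-symmetrize : (G : Fin m → Fin m → Parity) → (∀ r → G r r ≡ 0ℙ) →
                     pairSum (λ r r′ → G r r′ ⊕ G r′ r) ≡ ∑[ r < m ] ∑[ r′ < m ] G r r′
pairSum-symmetrize {m} G G-diag = begin
  pairSum (λ r r′ → G r r′ ⊕ G r′ r)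
    ≡⟨ pairSum-distrib-+ G (λ r r′ → G r′ r) ⟩
  pairSum G ⊕ pairSum (λ r r′ → G r′ r)
    ≡⟨ cong (pairSum G ⊕_) (∑-comm (λ r r′ → lt r r′ ⊗ G r′ r)) ⟩
  pairSum G ⊕ ∑[ r < m ] ∑[ r′ < m ] (lt r′ r ⊗ G r r′)
    ≡⟨ ∑∑-distrib-+ (λ r r′ → lt r r′ ⊗ G r r′) (λ r r′ → lt r′ r ⊗ G r r′) ⟨
  ∑[ r < m ] ∑[ r′ < m ] ((lt r r′ ⊗ G r r′) ⊕ (lt r′ r ⊗ G r r′))
    ≡⟨ ∑∑-cong pointwise ⟩
  ∑[ r < m ] ∑[ r′ < m ] G r r′ ∎
  where
  off-diagonal : ∀ {l e g p} → Comparison l e g → (e ≡ 1ℙ → p ≡ 0ℙ) → (l ⊗ p) ⊕ (g ⊗ p) ≡ p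
  off-diagonal less    _   = ℙ.+-identityʳ _
  off-diagonal equal   p≡0 = sym (p≡0 refl)
  off-diagonal greater _   = refl

  pointwise : ∀ r r′ → (lt r r′ ⊗ G r r′) ⊕ (lt r′ r ⊗ G r r′) ≡ G r r′
  pointwise r r′ = off-diagonal (compare r r′) on-diagonal
    where
    on-diagonal : eq r r′ ≡ 1ℙ → G r r′ ≡ 0ℙ
    -- In the case `no` the hypothesis would read `0ℙ ≡ 1ℙ`.
    on-diagonal _ with yes refl ← r ≟ r′ = G-diag r

-- Inversions of an orthogonal array

-- The first summand is lexicographic order by the first key, the second by the second key. If the
-- keys do not both tie, these orders disagree exactly when the keys compare strictly oppositely.
lex-swap : ∀ {l e g l′ e′ g′} → Comparison l e g → Comparison l′ e′ g′ → e ⊗ e′ ≡ 0ℙ →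
           (l ⊕ e ⊗ l′) ⊕ (l′ ⊕ e′ ⊗ l) ≡ (g ⊗ l′) ⊕ (l ⊗ g′)
lex-swap less    less    _ = refl
lex-swap less    equal   _ = refl
lex-swap less    greater _ = refl
lex-swap equal   less    _ = refl
lex-swap equal   greater _ = refl
lex-swap greater less    _ = refl
lex-swap greater equal   _ = refl
lex-swap greater greater _ = refl

-- Lexicographic orders with a common first key can differ only where it ties. There the second keys
-- decide, and the hypotheses make both of these comparisons strict.
lex-fan : ∀ {l e g l₁ e₁ g₁ l₂ e₂ g₂} →
          Comparison l e g → Comparison l₁ e₁ g₁ → Comparison l₂ e₂ g₂ →
          e ⊗ e₁ ≡ 0ℙ → e ⊗ e₂ ≡ 0ℙ →
          (l ⊕ e ⊗ l₁) ⊕ (l ⊕ e ⊗ l₂) ≡ (e ⊗ (g₁ ⊗ l₂)) ⊕ (e ⊗ (l₁ ⊗ g₂))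
lex-fan less    _       _       _ _ = refl
lex-fan greater _       _       _ _ = refl
lex-fan equal   less    less    _ _ = refl
lex-fan equal   less    greater _ _ = refl
lex-fan equal   greater less    _ _ = refl
lex-fan equal   greater greater _ _ = refl

module _ (A : OA k n) where
  open OA A renaming (matrix to a)

  -- Indicator that `r′` precedes `r` lexicographically in the columns `i`, `j`; the two
  -- alternatives exclude each other, so ⊕ serves as "or". `lexInversions i j` is then f_i(j).
  lex : (i j : Fin k) (r r′ : Fin (n * n)) → Parity
  lex i j r r′ = lt (a r′ i) (a r i) ⊕ eq (a r′ i) (a r i) ⊗ lt (a r′ j) (a r j)

  lexInversions : Fin k → Fin k → Parity
  lexInversions i j = pairSum (lex i j)

  crossing : (i j : Fin k) (r r′ : Fin (n * n)) → Parity
  crossing i j r r′ = lt (a r i) (a r′ i) ⊗ lt (a r′ j) (a r j)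

  crossing-diag : ∀ i j r → crossing i j r r ≡ 0ℙ
  crossing-diag i j r rewrite lt-irrefl (a r i) = refl

  row-unique : ∀ {r r′ i j} → i ≢ j → a r′ i ≡ a r i → a r′ j ≡ a r j → r ≡ r′
  row-unique i≢j p q =
    let (_ , _ , unique) = isOA _ _ i≢j _ _
    in trans (sym (unique (refl , refl))) (unique (p , q))

  agree-once : ∀ {r r′ i j} → r ≢ r′ → i ≢ j →
               eq (a r′ i) (a r i) ⊗ eq (a r′ j) (a r j) ≡ 0ℙ
  agree-once {r} {r′} {i} {j} r≢r′ i≢j with a r′ i ≟ a r i | a r′ j ≟ a r j
  ... | yes p | yes q = contradiction (row-unique i≢j p q) r≢r′
  ... | yes _ | no  _ = refl
  ... | no  _ | _     = refl

  module _ {c i : Fin k} (c≢i : c ≢ i) where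

    row-first : ∀ s x → a (row A c≢i s x) c ≡ s
    row-first s x = proj₁ (proj₁ (proj₂ (isOA c i c≢i s x)))

    row-second : ∀ s x → a (row A c≢i s x) i ≡ x
    row-second s x = proj₂ (proj₁ (proj₂ (isOA c i c≢i s x)))

    eq-row : ∀ r s x → eq r (row A c≢i s x) ≡ eq s (a r c) ⊗ eq x (a r i)
    eq-row r s x = trans
      (cong ⟦_⟧ (does-⇔ (mk⇔ to from) (r ≟ row A c≢i s x) ((s ≟ a r c) ×-dec (x ≟ a r i))))
      (⟦∧⟧ (does (s ≟ a r c)) (does (x ≟ a r i)))
      where
      to : r ≡ row A c≢i s x → s ≡ a r c × x ≡ a r i
      to refl = sym (row-first s x) , sym (row-second s x)
      from : s ≡ a r c × x ≡ a r i → r ≡ row A c≢i s x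
      from (refl , refl) = sym (proj₂ (proj₂ (isOA c i c≢i s x)) (refl , refl))

    -- By `eq-row`, every row is `row A c≢i s x` for exactly one pair (s, x). Inserting the sum of
    -- these indicators and exchanging sums lets `sum-eq` pick out the row belonging to each pair.
    sum-rows : (F : Fin (n * n) → Parity) →
               ∑[ r < n * n ] F r ≡ ∑[ s < n ] ∑[ x < n ] F (row A c≢i s x)
    sum-rows F = begin
      ∑[ r < n * n ] F r
        ≡⟨ sum-cong-≗ expand ⟩
      ∑[ r < n * n ] ∑[ s < n ] ∑[ x < n ] (eq r (row A c≢i s x) ⊗ F r)
        ≡⟨ ∑-comm (λ r s → ∑[ x < n ] (eq r (row A c≢i s x) ⊗ F r)) ⟩
      ∑[ s < n ] ∑[ r < n * n ] ∑[ x < n ] (eq r (row A c≢i s x) ⊗ F r)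
        ≡⟨ sum-cong-≗ (λ s → ∑-comm (λ r x → eq r (row A c≢i s x) ⊗ F r)) ⟩
      ∑[ s < n ] ∑[ x < n ] ∑[ r < n * n ] (eq r (row A c≢i s x) ⊗ F r)
        ≡⟨ ∑∑-cong (λ s x → sum-eq (row A c≢i s x) F) ⟩
      ∑[ s < n ] ∑[ x < n ] F (row A c≢i s x) ∎
      where
      expand : ∀ r → F r ≡ ∑[ s < n ] ∑[ x < n ] (eq r (row A c≢i s x) ⊗ F r)
      expand r = begin
        F r
          ≡⟨ sum-eq (a r c) (λ _ → F r) ⟨
        ∑[ s < n ] (eq s (a r c) ⊗ F r)
          ≡⟨ sum-cong-≗ (λ s → cong (eq s (a r c) ⊗_) (sum-eq (a r i) (λ _ → F r))) ⟨
        ∑[ s < n ] (eq s (a r c) ⊗ ∑[ x < n ] (eq x (a r i) ⊗ F r))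
          ≡⟨ sum-cong-≗ (λ s → *-distribˡ-sum (eq s (a r c)) (λ x → eq x (a r i) ⊗ F r)) ⟩
        ∑[ s < n ] ∑[ x < n ] (eq s (a r c) ⊗ (eq x (a r i) ⊗ F r))
          ≡⟨ ∑∑-cong (λ s x → ℙ.*-assoc (eq s (a r c)) (eq x (a r i)) (F r)) ⟨
        ∑[ s < n ] ∑[ x < n ] (eq s (a r c) ⊗ eq x (a r i) ⊗ F r)
          ≡⟨ ∑∑-cong (λ s x → cong (_⊗ F r) (eq-row r s x)) ⟨
        ∑[ s < n ] ∑[ x < n ] (eq r (row A c≢i s x) ⊗ F r) ∎

    sum-row-pairs : (F : Fin (n * n) → Fin (n * n) → Parity) →
      ∑[ r < n * n ] ∑[ r′ < n * n ] F r r′ ≡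
      ∑[ s < n ] ∑[ x < n ] ∑[ s′ < n ] ∑[ y < n ] F (row A c≢i s x) (row A c≢i s′ y)
    sum-row-pairs F = trans
      (sum-rows (λ r → ∑[ r′ < n * n ] F r r′))
      (∑∑-cong λ s x → sum-rows (F (row A c≢i s x)))

  -- Rows with symbol s in column `c` are determined by their entries in column `i`. Two of them,
  -- with entries x and y there, cross exactly when (x, y) is an inversion of ρ_s.
  tied-crossings : ∀ {c i j} (c≢i : c ≢ i) (c≢j : c ≢ j) →
    ∑[ r < n * n ] ∑[ r′ < n * n ] (eq (a r′ c) (a r c) ⊗ crossing i j r r′) ≡
    ∑[ s < n ] π (ρ A c≢i c≢j s)
  tied-crossings {c} {i} {j} c≢i c≢j = begin
    ∑[ r < n * n ] ∑[ r′ < n * n ] (eq (a r′ c) (a r c) ⊗ crossing i j r r′)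
      ≡⟨ sum-row-pairs c≢i (λ r r′ → eq (a r′ c) (a r c) ⊗ crossing i j r r′) ⟩
    ∑[ s < n ] ∑[ x < n ] ∑[ s′ < n ] ∑[ y < n ]
      (eq (a (R s′ y) c) (a (R s x) c) ⊗ crossing i j (R s x) (R s′ y))
      ≡⟨ ∑∑-cong (λ s x → ∑∑-cong λ s′ y →
           cong₂ _⊗_ (cong₂ eq (row-first c≢i s′ y) (row-first c≢i s x))
             (cong (_⊗ lt (t s′ y) (t s x)) (cong₂ lt (row-second c≢i s x) (row-second c≢i s′ y)))) ⟩
    ∑[ s < n ] ∑[ x < n ] ∑[ s′ < n ] ∑[ y < n ] (eq s′ s ⊗ (lt x y ⊗ lt (t s′ y) (t s x)))
      ≡⟨ ∑∑-cong (λ s x → sum-cong-≗ λ s′ →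
           *-distribˡ-sum (eq s′ s) (λ y → lt x y ⊗ lt (t s′ y) (t s x))) ⟨
    ∑[ s < n ] ∑[ x < n ] ∑[ s′ < n ] (eq s′ s ⊗ ∑[ y < n ] (lt x y ⊗ lt (t s′ y) (t s x)))
      ≡⟨ ∑∑-cong (λ s x → sum-eq s (λ s′ → ∑[ y < n ] (lt x y ⊗ lt (t s′ y) (t s x)))) ⟩
    ∑[ s < n ] ∑[ x < n ] ∑[ y < n ] (lt x y ⊗ lt (t s y) (t s x))
      ≡⟨ ∑∑-cong (λ s x → sum-cong-≗ λ y → ⟦∧⟧ (does (x <? y)) (does (t s y <? t s x))) ⟨
    ∑[ s < n ] π (ρ A c≢i c≢j s) ∎
    where
    R : Fin n → Fin n → Fin (n * n)
    R = row A c≢i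
    t : Fin n → Fin n → Fin n
    t = translate A c≢i j

  -- By `lex-fan`, the two lexicographic counts cancel except on pairs tied in column `c`, where the
  -- crossings of columns `i` and `j` remain, in both orders of the rows.
  τ≡lexInversions : ∀ c i j (c≢i : c ≢ i) (c≢j : c ≢ j) (i≢j : i ≢ j) →
                    τ A c i j c≢i c≢j i≢j ≡ lexInversions c i ⊕ lexInversions c j
  τ≡lexInversions c i j c≢i c≢j i≢j = begin
    ∑[ s < n ] π (ρ A c≢i c≢j s)
      ≡⟨ tied-crossings c≢i c≢j ⟨
    ∑[ r < n * n ] ∑[ r′ < n * n ] F r r′
      ≡⟨ pairSum-symmetrize F F-diag ⟨
    pairSum (λ r r′ → F r r′ ⊕ F r′ r)
      ≡⟨ pairSum-cong pointwise ⟨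
    pairSum (λ r r′ → lex c i r r′ ⊕ lex c j r r′)
      ≡⟨ pairSum-distrib-+ (lex c i) (lex c j) ⟩
    lexInversions c i ⊕ lexInversions c j ∎
    where
    F : Fin (n * n) → Fin (n * n) → Parity
    F r r′ = eq (a r′ c) (a r c) ⊗ crossing i j r r′

    F-diag : ∀ r → F r r ≡ 0ℙ
    F-diag r = trans (cong (eq (a r c) (a r c) ⊗_) (crossing-diag i j r)) (ℙ.*-zeroʳ _)

    pointwise : ∀ r r′ → r ≢ r′ → lex c i r r′ ⊕ lex c j r r′ ≡ F r r′ ⊕ F r′ r
    pointwise r r′ r≢r′ = trans
      (lex-fan (compare (a r′ c) (a r c)) (compare (a r′ i) (a r i)) (compare (a r′ j) (a r j))
        (agree-once r≢r′ c≢i) (agree-once r≢r′ c≢j))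
      (cong (λ e → F r r′ ⊕ e ⊗ crossing i j r′ r) (eq-sym (a r′ c) (a r c)))

  -- The right side mentions only `n`, so it is the same for any two arrays; this makes `difference`
  -- symmetric.
  lexInversions-swap : ∀ {i j} → i ≢ j → lexInversions i j ⊕ lexInversions j i ≡
    ∑[ x < n ] ∑[ y < n ] ∑[ x′ < n ] ∑[ y′ < n ] (lt x x′ ⊗ lt y′ y)
  lexInversions-swap {i} {j} i≢j = begin
    lexInversions i j ⊕ lexInversions j i
      ≡⟨ pairSum-distrib-+ (lex i j) (lex j i) ⟨
    pairSum (λ r r′ → lex i j r r′ ⊕ lex j i r r′)
      ≡⟨ pairSum-cong (λ r r′ r≢r′ →
           lex-swap (compare (a r′ i) (a r i)) (compare (a r′ j) (a r j)) (agree-once r≢r′ i≢j)) ⟩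
    pairSum (λ r r′ → crossing i j r r′ ⊕ crossing i j r′ r)
      ≡⟨ pairSum-symmetrize (crossing i j) (crossing-diag i j) ⟩
    ∑[ r < n * n ] ∑[ r′ < n * n ] crossing i j r r′
      ≡⟨ sum-row-pairs i≢j (crossing i j) ⟩
    ∑[ x < n ] ∑[ y < n ] ∑[ x′ < n ] ∑[ y′ < n ] crossing i j (row A i≢j x y) (row A i≢j x′ y′)
      ≡⟨ ∑∑-cong (λ x y → ∑∑-cong λ x′ y′ → cong₂ _⊗_
           (cong₂ lt (row-first i≢j x y) (row-first i≢j x′ y′))
           (cong₂ lt (row-second i≢j x′ y′) (row-second i≢j x y))) ⟩
    ∑[ x < n ] ∑[ y < n ] ∑[ x′ < n ] ∑[ y′ < n ] (lt x x′ ⊗ lt y′ y) ∎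

-- Arrays with one column more than symbols

module _ (A : OA (suc (suc n)) (suc n)) where
  open OA A renaming (matrix to a)

  -- Let r′ have the entry s ≠ r_0 in column 0.  The row r meets the n rows with
  -- entry s in column 0 once in each of the n other columns, and in different
  -- columns it meets different ones.  So r′ is among them, by the pigeonhole
  -- principle applied to the entries in column 1.
  rows-agree : ∀ r r′ → ∃ λ c → a r′ c ≡ a r c
  rows-agree r r′ with a r′ zero ≟ a r zero
  ... | yes r′₀≡r₀ = zero , r′₀≡r₀
  ... | no  r′₀≢r₀ = find (pigeonhole ≤-refl entry)
    where
    meeting : Fin (suc n) → Fin (suc n * suc n)
    meeting i = row A (0≢1+n {i = i}) (a r′ zero) (a r (suc i))

    entry : Fin (suc (suc n)) → Fin (suc n)
    entry zero    = a r′ (suc zero)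
    entry (suc i) = a (meeting i) (suc zero)

    meeting-0 : ∀ i → a (meeting i) zero ≡ a r′ zero
    meeting-0 i = row-first A 0≢1+n (a r′ zero) (a r (suc i))

    meeting-suc : ∀ i → a (meeting i) (suc i) ≡ a r (suc i)
    meeting-suc i = row-second A 0≢1+n (a r′ zero) (a r (suc i))

    find : (∃ λ i → ∃ λ j → i <ᶠ j × entry i ≡ entry j) → ∃ λ c → a r′ c ≡ a r c
    find (zero , suc j , _ , e) = suc j , trans (cong (λ q → a q (suc j)) r′≡) (meeting-suc j)
      where
      r′≡ : r′ ≡ meeting j
      r′≡ = row-unique A 0≢1+n (meeting-0 j) (sym e)
    find (suc i , suc j , i<j , e) = contradiction
      (trans (sym (meeting-0 i)) (cong (λ q → a q zero) (sym r≡))) r′₀≢r₀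
      where
      same : meeting j ≡ meeting i
      same = row-unique A 0≢1+n (trans (meeting-0 i) (sym (meeting-0 j))) e
      r≡ : r ≡ meeting i
      r≡ = row-unique A (<⇒≢ i<j) (meeting-suc i)
             (trans (cong (λ q → a q (suc j)) (sym same)) (meeting-suc j))

  -- `rows-agree` provides one nonzero term, and `row-unique` excludes a second.
  agree-odd : ∀ {r r′} → r ≢ r′ → ∑[ c < suc (suc n) ] eq (a r′ c) (a r c) ≡ 1ℙ
  agree-odd {r} {r′} r≢r′ = trans (sum-cong-≗ pointwise) (sum-eq c (λ _ → 1ℙ))
    where
    c : Fin (suc (suc n))
    c = proj₁ (rows-agree r r′)

    agree⇒≡ : ∀ {i} → a r′ i ≡ a r i → i ≡ c
    agree⇒≡ {i} p with i ≟ c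
    ... | yes i≡c = i≡c
    ... | no  i≢c = contradiction (row-unique A i≢c p (proj₂ (rows-agree r r′))) r≢r′

    pointwise : ∀ i → eq (a r′ i) (a r i) ≡ eq i c ⊗ 1ℙ
    pointwise i = trans
      (cong ⟦_⟧ (does-⇔ (mk⇔ agree⇒≡ λ { refl → proj₂ (rows-agree r r′) }) (a r′ i ≟ a r i) (i ≟ c)))
      (sym (ℙ.*-identityʳ _))

  -- Two distinct rows that differ in column `j` agree in exactly one other column, and its tie term
  -- contributes the comparison in column `j`. This supplies the term missing from the sum over all
  -- columns.
  lexInversions-column : ∀ j →
    ∑[ i < suc n ] lexInversions A (punchIn j i) j ≡
    pairSum (λ r r′ → ∑[ i < suc (suc n) ] lt (a r′ i) (a r i))
  lexInversions-column j = trans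
    (sum-pairSum (λ i → lex A (punchIn j i) j))
    (pairSum-cong pointwise)
    where
    cancel : ∀ {l e g} L E → Comparison l e g → e ⊕ E ≡ 1ℙ → L ⊕ E ⊗ l ≡ l ⊕ L
    cancel L 1ℙ less    _ = ℙ.+-comm L 1ℙ
    cancel L E  equal   _ = trans (cong (L ⊕_) (ℙ.*-zeroʳ E)) (ℙ.+-identityʳ L)
    cancel L E  greater _ = trans (cong (L ⊕_) (ℙ.*-zeroʳ E)) (ℙ.+-identityʳ L)

    pointwise : ∀ r r′ → r ≢ r′ →
      ∑[ i < suc n ] lex A (punchIn j i) j r r′ ≡ ∑[ i < suc (suc n) ] lt (a r′ i) (a r i)
    pointwise r r′ r≢r′ = begin
      ∑[ i < suc n ] (l (punchIn j i) ⊕ e (punchIn j i) ⊗ l j)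
        ≡⟨ ∑-distrib-+ (l ∘ punchIn j) (λ i → e (punchIn j i) ⊗ l j) ⟩
      sum (l ∘ punchIn j) ⊕ ∑[ i < suc n ] (e (punchIn j i) ⊗ l j)
        ≡⟨ cong (sum (l ∘ punchIn j) ⊕_) (*-distribʳ-sum (l j) (e ∘ punchIn j)) ⟨
      sum (l ∘ punchIn j) ⊕ sum (e ∘ punchIn j) ⊗ l j
        ≡⟨ cancel _ _ (compare (a r′ j) (a r j)) (trans (sym (sum-remove {i = j} e)) (agree-odd r≢r′)) ⟩
      l j ⊕ sum (l ∘ punchIn j)
        ≡⟨ sum-remove {i = j} l ⟨
      sum l ∎
      where
      l e : Fin (suc (suc n)) → Parity
      l i = lt (a r′ i) (a r i)
      e i = eq (a r′ i) (a r i)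

-- Symmetric parity matrices with equal off-diagonal column sums

module _ (D : Fin (suc (suc n)) → Fin (suc (suc n)) → Parity)
         (D-sym : ∀ {i j} → i ≢ j → D i j ≡ D j i)
         (S : Parity) (D-column : ∀ j → ∑[ i < suc n ] D (punchIn j i) j ≡ S)
         {a : Parity} (D-inner : ∀ {i j} → i ≢ j → D (suc i) (suc j) ≡ a) where

  -- Off the diagonal, column `suc j` consists of this entry and `n` copies of `a`.
  first-row : ∀ j → D zero (suc j) ≡ S ⊕ ∑[ i < n ] a
  first-row j = ⊕-transpose (D zero (suc j)) (∑[ i < n ] a) (begin
    D zero (suc j) ⊕ ∑[ i < n ] a
      ≡⟨ cong (D zero (suc j) ⊕_) (sum-cong-≗ λ i → D-inner (punchInᵢ≢i j i)) ⟨
    D zero (suc j) ⊕ ∑[ i < n ] D (suc (punchIn j i)) (suc j)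
      ≡⟨ D-column (suc j) ⟩
    S ∎)

  off-diagonal-const : (∀ j → D zero (suc j) ≡ a) → ∀ {i j} → i ≢ j → D i j ≡ a
  off-diagonal-const first {zero}  {zero}  i≢j = contradiction refl i≢j
  off-diagonal-const first {zero}  {suc j} i≢j = first j
  off-diagonal-const first {suc i} {zero}  i≢j = trans (D-sym i≢j) (first i)
  off-diagonal-const first {suc i} {suc j} i≢j = D-inner (i≢j ∘ cong suc)

  const-from-first : D zero (suc zero) ≡ a → ∀ {i j} → i ≢ j → D i j ≡ a
  const-from-first D₀₁≡a = off-diagonal-const λ j →
    trans (first-row j) (trans (sym (first-row zero)) D₀₁≡a)

  -- By `first-row`, column 0 consists of `suc n` equal entries, an even number, so `S` vanishes.
  -- Each of these entries is then a sum of `n` copies of `a`, with `n` odd.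
  const-from-even : 2 ∣ suc n → ∀ {i j} → i ≢ j → D i j ≡ a
  const-from-even (divides q 1+n≡q*2) = off-diagonal-const λ j → begin
    D zero (suc j)        ≡⟨ first-row j ⟩
    S ⊕ ∑[ i < n ] a      ≡⟨ cong (_⊕ ∑[ i < n ] a) S≡0 ⟩
    ∑[ i < n ] a          ≡⟨ ⊕-transpose a (∑[ i < n ] a) (sum-const a) ⟨
    a                     ∎
    where
    sum-const : ∀ p → ∑[ i < suc n ] p ≡ 0ℙ
    sum-const p = subst (λ l → ∑[ i < l ] p ≡ 0ℙ) (sym 1+n≡q*2) (sum-const-even q p)

    S≡0 : S ≡ 0ℙ
    S≡0 = begin
      S                                       ≡⟨ D-column zero ⟨
      ∑[ i < suc n ] D (suc i) zero           ≡⟨ sum-cong-≗ (λ i → trans (D-sym {suc i} λ ()) (first-row i)) ⟩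
      ∑[ i < suc n ] (S ⊕ ∑[ i′ < n ] a)      ≡⟨ sum-const (S ⊕ ∑[ i′ < n ] a) ⟩
      0ℙ                                      ∎

-- The difference of two arrays

module _ (A B : OA (suc (suc n)) (suc n)) where

  difference : Fin (suc (suc n)) → Fin (suc (suc n)) → Parity
  difference i j = lexInversions A i j ⊕ lexInversions B i j

  difference-sym : ∀ {i j} → i ≢ j → difference i j ≡ difference j i
  difference-sym {i} {j} i≢j = ⊕-exchange
    (lexInversions A i j) (lexInversions A j i) (lexInversions B i j) (lexInversions B j i)
    (trans (lexInversions-swap A i≢j) (sym (lexInversions-swap B i≢j)))

  difference-column : ∀ j → ∑[ i < suc n ] difference (punchIn j i) j ≡
    pairSum (λ r r′ → ∑[ i < suc (suc n) ] lt (OA.matrix A r′ i) (OA.matrix A r i)) ⊕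
    pairSum (λ r r′ → ∑[ i < suc (suc n) ] lt (OA.matrix B r′ i) (OA.matrix B r i))
  difference-column j = trans
    (∑-distrib-+ (λ i → lexInversions A (punchIn j i) j) (λ i → lexInversions B (punchIn j i) j))
    (cong₂ _⊕_ (lexInversions-column A j) (lexInversions-column B j))

  -- τ^c_ij is a sum of two values of f_c, so a constant change of f enters twice and cancels.
  difference-const⇒≈τ : ∀ {a} → (∀ {i j} → i ≢ j → difference i j ≡ a) → τ A ≈τ τ B
  difference-const⇒≈τ const c i j c≢i c≢j i≢j = begin
    τ A c i j c≢i c≢j i≢j                    ≡⟨ τ≡lexInversions A c i j c≢i c≢j i≢j ⟩
    lexInversions A c i ⊕ lexInversions A c j
      ≡⟨ ⊕-exchange (lexInversions A c i) (lexInversions B c i) (lexInversions A c j) (lexInversions B c j)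
           (trans (const c≢i) (sym (const c≢j))) ⟩
    lexInversions B c i ⊕ lexInversions B c j  ≡⟨ τ≡lexInversions B c i j c≢i c≢j i≢j ⟨
    τ B c i j c≢i c≢j i≢j                    ∎

-- Counting

-- The recursion follows `pair`: `n` pairs begin with `zero`, and the others are shifted from the
-- smaller set.
numberOfPairs : ℕ → ℕ
numberOfPairs zero    = 0
numberOfPairs (suc n) = n + numberOfPairs n

numberOfPairs≡nC2 : ∀ n → numberOfPairs n ≡ n C 2
numberOfPairs≡nC2 zero    = refl
numberOfPairs≡nC2 (suc n) = trans
  (cong₂ _+_ (sym (nC1≡n n)) (numberOfPairs≡nC2 n))
  (nCk+nC[k+1]≡[n+1]C[k+1] n 1)

pair : ∀ n → Fin (numberOfPairs n) → Fin n × Fin n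
pair (suc n) m = [ (λ j → zero , suc j) , Product.map suc suc ∘ pair n ]′ (splitAt n m)

pair-covers : ∀ {n} {i j : Fin n} → i <ᶠ j → ∃ λ m → pair n m ≡ (i , j)
pair-covers {suc n} {zero} {suc j} _ =
  j ↑ˡ numberOfPairs n , cong [ _ , _ ]′ (splitAt-↑ˡ n j (numberOfPairs n))
pair-covers {suc n} {suc i} {suc j} (s<s i<j) =
  let m , e = pair-covers i<j
  in n ↑ʳ m , trans (cong [ _ , _ ]′ (splitAt-↑ʳ n (numberOfPairs n) m)) (cong (Product.map suc suc) e)

sym-from-pairs : {D : Fin n → Fin n → Parity} {a : Parity} →
                 (∀ {i j} → i ≢ j → D i j ≡ D j i) →
                 (∀ m → uncurry D (pair n m) ≡ a) → ∀ {i j} → i ≢ j → D i j ≡ a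
sym-from-pairs {D = D} D-sym D-pairs {i} {j} i≢j with <-cmp i j
... | tri< i<j _ _ = let m , e = pair-covers i<j in trans (cong (uncurry D) (sym e)) (D-pairs m)
... | tri≈ _ i≡j _ = contradiction i≡j i≢j
... | tri> _ _ j<i = let m , e = pair-covers j<i in
  trans (D-sym i≢j) (trans (cong (uncurry D) (sym e)) (D-pairs m))

AllPairs-lookup : ∀ {X : Set} {R : X → X → Set} {xs : List X} → AllPairs R xs →
                  ∀ {i j} → i <ᶠ j → R (lookup xs i) (lookup xs j)
AllPairs-lookup {xs = _ ∷ xs} (r ∷ _)  {zero}  {suc j} _         = All.lookup r (∈-lookup j)
AllPairs-lookup {xs = _ ∷ xs} (_ ∷ rs) {suc i} {suc j} (s<s i<j) = AllPairs-lookup rs i<j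

τ-decSetoid : ℕ → DecSetoid 0ℓ 0ℓ
τ-decSetoid k = record
  { Carrier = τ-Parity k
  ; _≈_ = _≈τ_
  ; isDecEquivalence = record
    { isEquivalence = record
      { refl  = λ c i j _ _ _ → refl
      ; sym   = λ t≈u c i j c≢i c≢j i≢j → sym (t≈u c i j c≢i c≢j i≢j)
      ; trans = λ t≈u u≈v c i j c≢i c≢j i≢j →
                  trans (t≈u c i j c≢i c≢j i≢j) (u≈v c i j c≢i c≢j i≢j)
      }
    ; _≟_ = _≈τ?_
    }
  }

toFin₂ : Parity → Fin 2
toFin₂ 0ℙ = zero
toFin₂ 1ℙ = suc zero

toFin₂-injective : ∀ p q → toFin₂ p ≡ toFin₂ q → p ≡ q
toFin₂-injective 0ℙ 0ℙ _ = refl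
toFin₂-injective 1ℙ 1ℙ _ = refl

-- Choose an array for each listed τ-parity. With more than 2 ^ m of them, two chosen arrays share
-- their code and hence their τ-parity, but the deduplicated list has no repetitions.
ℬ≤-from-code : (code : OA k n → Fin m → Parity) →
               (∀ A B → (∀ b → code A b ≡ code B b) → τ A ≈τ τ B) → ℬ[ k , n ]≤ m
ℬ≤-from-code {k} {n} {m} code code-injective = ≮⇒≥ collision-free
  where
  parities : List (τ-Parity k)
  parities = deduplicate _≈τ?_ (map τ (allOAs k n))

  source : ∀ i → ∃ λ A → lookup parities i ≡ τ A
  source i =
    let A , _ , e = ∈-map⁻ τ (∈-deduplicate⁻ _≈τ?_ (map τ (allOAs k n)) (∈-lookup i))
    in A , e

  encode : Fin (length parities) → Fin (2 ^ m)
  encode i = funToFin (toFin₂ ∘ code (proj₁ (source i)))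

  encode-code : ∀ i b → finToFun (encode i) b ≡ toFin₂ (code (proj₁ (source i)) b)
  encode-code i = finToFun-funToFin (toFin₂ ∘ code (proj₁ (source i)))

  collision-free : 2 ^ m < length parities → _
  collision-free m<l with pigeonhole m<l encode
  ... | i , j , i<j , e =
    AllPairs-lookup (deduplicate-! (τ-decSetoid k) (map τ (allOAs k n))) i<j
      (subst₂ _≈τ_ (sym (proj₂ (source i))) (sym (proj₂ (source j)))
        (code-injective _ _ λ b → toFin₂-injective _ _
          (trans (sym (encode-code i b)) (trans (cong (λ f → finToFun f b) e) (encode-code j b)))))

-- The two bounds

innerInversions : OA (suc n) n → Fin (numberOfPairs n) → Parity
innerInversions {n} A m = let i , j = pair n m in lexInversions A (suc i) (suc j)

-- Since `base` is added to every bit, equal codes say that `difference` has the same value on all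
-- inner pairs as at (0, 1), whatever that value is.
ℬ≤nC2 : ∀ n → ℬ[ suc (suc n) , suc n ]≤ (suc n C 2)
ℬ≤nC2 n = subst (ℬ[ suc (suc n) , suc n ]≤_) (numberOfPairs≡nC2 (suc n))
  (ℬ≤-from-code (λ A m → innerInversions A m ⊕ base A) λ A B e →
    difference-const⇒≈τ A B
      (const-from-first (difference A B) (difference-sym A B) _ (difference-column A B)
        (sym-from-pairs (λ i≢j → difference-sym A B (i≢j ∘ suc-injective))
          λ m → ⊕-exchange (innerInversions A m) (base A) (innerInversions B m) (base B) (e m))
        refl))
  where
  base : OA (suc (suc n)) (suc n) → Parity
  base A = lexInversions A zero (suc zero)

-- Here `base` is the bit of the first inner pair, so that pair needs no bit of its own, and column
-- 0 is settled by `const-from-even`.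
ℬ≤nC2∸1 : ∀ n → 2 ∣ suc (suc n) → ℬ[ suc (suc (suc n)) , suc (suc n) ]≤ (suc (suc n) C 2 ∸ 1)
ℬ≤nC2∸1 n even = subst (λ l → ℬ[ suc (suc (suc n)) , suc (suc n) ]≤ (l ∸ 1))
  (numberOfPairs≡nC2 (suc (suc n)))
  -- `numberOfPairs (suc (suc n))` reduces to a successor, so `∸ 1` computes and `suc m` runs
  -- through all pairs but the first.
  (ℬ≤-from-code (λ A m → innerInversions A (suc m) ⊕ base A) λ A B e →
    difference-const⇒≈τ A B
      (const-from-even (difference A B) (difference-sym A B) _ (difference-column A B)
        (sym-from-pairs (λ i≢j → difference-sym A B (i≢j ∘ suc-injective)) λ
          { zero    → refl
          ; (suc m) → ⊕-exchange (innerInversions A (suc m)) (base A)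
                                 (innerInversions B (suc m)) (base B) (e m) })
        even))
  where
  base : OA (suc (suc (suc n))) (suc (suc n)) → Parity
  base A = innerInversions A zero

corollary5p6 : ∀ (n : ℕ) → 2 ≤ n →
    (2 ∤ n → ℬ[ suc n , n ]≤ (n C 2)) ×
    (2 ∣ n → ℬ[ suc n , n ]≤ (n C 2 ∸ 1))
corollary5p6 (suc zero)    (s≤s ())
corollary5p6 (suc (suc n)) _ = (λ _ → ℬ≤nC2 (suc n)) , ℬ≤nC2∸1 n
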